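{- For every nonnegative integer $n$, $$\sum_{k=0}^{\infty}(-1)^k(4k+1)\,\frac{(-n)_k\,(-2n-\tfrac12)_k\,(\tfrac12)_k}{k!\,(n+\tfrac32)_k\,(2n+2)_k}=\left(\frac{2^2}{3^3}\right)^n\frac{(\tfrac32)_n^2}{(\tfrac43)_n(\tfrac23)_n}.$$ (The sum is finite, since $(-n)_k=0$ for $k>n$.)
   Context: $(a)_j=\Gamma(a+j)/\Gamma(a)=a(a+1)\cdots(a+j-1)$ denotes the rising factorial (Pochhammer symbol), with $(a)_0=1$. -}

module Defs where

open import Data.Fin.Base using (toℕ)
open import Data.Integer.Base using (+_)
open import Data.Nat.Base as ℕ using (ℕ; zero; suc; _!)
open import Data.Nat.Properties using (_!≢0)
open import Data.Product.Base using (∃-syntax)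
open import Data.Rational.Base
  using (ℚ; 0ℚ; 1ℚ; ½; _+_; _*_; _-_; -_; _/_; _÷_; _<_; ∣_∣;
         NonZero; Positive; +-0-rawMonoid; +-*-rawSemiring)
open import Data.Rational.Properties
  using (normalize-nonNeg; normalize-pos; nonNeg+pos⇒pos; pos+nonNeg⇒pos; pos*pos⇒pos;
         pos⇒nonZero)

open import Algebra.Definitions.RawMonoid +-0-rawMonoid using (sum)
open import Algebra.Definitions.RawSemiring +-*-rawSemiring using (_^_)

⟦_⟧ : ℕ → ℚ
⟦ n ⟧ = + n / 1

-- The product form of (a)ⱼ, since the quotient of gamma functions is undefined
-- at the nonpositive integer a = -n.
rising : ℚ → ℕ → ℚ
rising a zero    = 1ℚ
rising a (suc j) = rising a j * (a + ⟦ j ⟧)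

-- Convergence in ℚ of the partial sums f 0 + … + f (N - 1).
HasSum : (ℕ → ℚ) → ℚ → Set
HasSum f s =
  ∀ ε → 0ℚ < ε →
  ∃[ N₀ ] (∀ N → N₀ ℕ.≤ N → ∣ sum {N} (λ k → f (toℕ k)) - s ∣ < ε)

rising-pos : ∀ a → .{{Positive a}} → ∀ j → Positive (rising a j)
rising-pos a zero    = _
rising-pos a (suc j) =
  pos*pos⇒pos (rising a j) {{rising-pos a j}} (a + ⟦ j ⟧)
    {{pos+nonNeg⇒pos a ⟦ j ⟧ {{normalize-nonNeg j 1}}}}

numerator : ℕ → ℕ → ℚ
numerator n k =
  rising (- ⟦ n ⟧) k * rising (- ⟦ 2 ℕ.* n ⟧ - ½) k * rising ½ k

denominator : ℕ → ℕ → ℚ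
denominator n k =
  ⟦ k ! ⟧ * rising (⟦ n ⟧ + + 3 / 2) k * rising (⟦ 2 ℕ.* n ℕ.+ 2 ⟧) k

denominator≢0 : ∀ n k → NonZero (denominator n k)
denominator≢0 n k = pos⇒nonZero (denominator n k) {{den>0}}
  where
  k!>0 : Positive ⟦ k ! ⟧
  k!>0 = normalize-pos (k !) 1 {{_}} {{k !≢0}}

  a>0 : Positive (⟦ n ⟧ + + 3 / 2)
  a>0 = nonNeg+pos⇒pos ⟦ n ⟧ {{normalize-nonNeg n 1}} (+ 3 / 2)

  m+2≢0 : ∀ m → ℕ.NonZero (m ℕ.+ 2)
  m+2≢0 zero    = _
  m+2≢0 (suc m) = _

  b>0 : Positive ⟦ 2 ℕ.* n ℕ.+ 2 ⟧
  b>0 = normalize-pos (2 ℕ.* n ℕ.+ 2) 1 {{_}} {{m+2≢0 (2 ℕ.* n)}}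

  den>0 : Positive (denominator n k)
  den>0 =
    pos*pos⇒pos (⟦ k ! ⟧ * rising (⟦ n ⟧ + + 3 / 2) k)
      {{pos*pos⇒pos ⟦ k ! ⟧ {{k!>0}}
         (rising (⟦ n ⟧ + + 3 / 2) k) {{rising-pos _ {{a>0}} k}}}}
      (rising ⟦ 2 ℕ.* n ℕ.+ 2 ⟧ k) {{rising-pos _ {{b>0}} k}}

summand : ℕ → ℕ → ℚ
summand n k =
  (- 1ℚ) ^ k * ⟦ 4 ℕ.* k ℕ.+ 1 ⟧ * (numerator n k ÷ denominator n k)
  where instance _ = denominator≢0 n k

closedForm : ℕ → ℚ
closedForm n =
  (+ (2 ℕ.^ 2) / (3 ℕ.^ 3)) ^ n *
  (rising (+ 3 / 2) n ^ 2 ÷ (rising (+ 4 / 3) n * rising (+ 2 / 3) n))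
  where
  instance
    _ : NonZero (rising (+ 4 / 3) n * rising (+ 2 / 3) n)
    _ = pos⇒nonZero (rising (+ 4 / 3) n * rising (+ 2 / 3) n)
          {{pos*pos⇒pos (rising (+ 4 / 3) n) {{rising-pos _ n}}
                        (rising (+ 2 / 3) n) {{rising-pos _ n}}}}

{-# OPTIONS --safe #-}

-- The series is the case c = -2n - 1/2, d = 2n + 2 of the well-poised sum
--   Σₖ (-1)ᵏ (4k+1) (-n)ₖ (c)ₖ (1/2)ₖ / (k! (n+3/2)ₖ (d)ₖ) = (3/2)ₙ / (d)ₙ,   c + d = 3/2,
-- in which d no longer depends on n, so that induction on n applies: writing t(n,k) for
-- the summand, (n+d) t(n+1,k) - (n+3/2) t(n,k) telescopes in k.
module Submission where

open import Defs
open import Data.Fin.Base using (toℕ)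
open import Data.Integer.Base as ℤ using (+_)
import Data.Integer.Properties as ℤ
open import Data.Nat.Base as ℕ using (ℕ; zero; suc; _<_; _!; s≤s; z≤n)
open import Data.Nat.Properties as ℕ using (_!≢0)
open import Data.Product.Base using (_×_; _,_)
open import Data.Rational.Base as ℚ
  using (ℚ; 0ℚ; 1ℚ; ½; _+_; _*_; _-_; -_; _/_; 1/_; ∣_∣;
         NonZero; Positive; toℚᵘ; +-*-rawSemiring)
open import Data.Rational.Properties
open import Data.Rational.Solver using (module +-*-Solver)
open import Data.Rational.Unnormalised.Base as ℚᵘ using (mkℚᵘ; *≡*)
import Data.Rational.Unnormalised.Properties as ℚᵘ
open import Relation.Nullary.Decidable.Core using (yes; no)
open import Relation.Binary.PropositionalEquality
open import Algebra.Definitions.RawSemiring +-*-rawSemiring using (_^_)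
open import Algebra.Properties.Monoid.Sum +-0-monoid using (sum; sum-cong-≗)
open +-*-Solver using (solve; con; _:+_; _:*_; _:-_; :-_; _:=_)

-- The embedding of the naturals into the rationals.

⟦⟧-homo-+ : ∀ m n → ⟦ m ℕ.+ n ⟧ ≡ ⟦ m ⟧ + ⟦ n ⟧
-- `_/_` normalises by a gcd that is stuck on variables, so the sum is compared among unnormalised
-- fractions.
⟦⟧-homo-+ m n = toℚᵘ-injective (begin
  toℚᵘ ⟦ m ℕ.+ n ⟧             ≈⟨ toℚᵘ-fromℚᵘ (mkℚᵘ (+ (m ℕ.+ n)) 0) ⟩
  mkℚᵘ (+ (m ℕ.+ n)) 0
    ≈⟨ *≡* (cong (ℤ._* + 1) (sym (cong₂ ℤ._+_ (ℤ.*-identityʳ (+ m)) (ℤ.*-identityʳ (+ n))))) ⟩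
  mkℚᵘ (+ m) 0 ℚᵘ.+ mkℚᵘ (+ n) 0
    ≈⟨ ℚᵘ.+-cong (toℚᵘ-fromℚᵘ (mkℚᵘ (+ m) 0)) (toℚᵘ-fromℚᵘ (mkℚᵘ (+ n) 0)) ⟨
  toℚᵘ ⟦ m ⟧ ℚᵘ.+ toℚᵘ ⟦ n ⟧   ≈⟨ toℚᵘ-homo-+ ⟦ m ⟧ ⟦ n ⟧ ⟨
  toℚᵘ (⟦ m ⟧ + ⟦ n ⟧)         ∎)
  where open ℚᵘ.≃-Reasoning

⟦⟧-homo-* : ∀ m n → ⟦ m ℕ.* n ⟧ ≡ ⟦ m ⟧ * ⟦ n ⟧
⟦⟧-homo-* zero    n = sym (*-zeroˡ ⟦ n ⟧)
⟦⟧-homo-* (suc m) n = begin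
  ⟦ n ℕ.+ m ℕ.* n ⟧          ≡⟨ ⟦⟧-homo-+ n (m ℕ.* n) ⟩
  ⟦ n ⟧ + ⟦ m ℕ.* n ⟧        ≡⟨ cong (λ z → ⟦ n ⟧ + z) (⟦⟧-homo-* m n) ⟩
  ⟦ n ⟧ + ⟦ m ⟧ * ⟦ n ⟧      ≡⟨ solve 2 (λ x y → y :+ x :* y := (con 1ℚ :+ x) :* y)
                                  refl ⟦ m ⟧ ⟦ n ⟧ ⟩
  (1ℚ + ⟦ m ⟧) * ⟦ n ⟧       ≡⟨ cong (_* ⟦ n ⟧) (⟦⟧-homo-+ 1 m) ⟨
  ⟦ suc m ⟧ * ⟦ n ⟧          ∎
  where open ≡-Reasoning

⟦suc⟧ : ∀ n → ⟦ suc n ⟧ ≡ 1ℚ + ⟦ n ⟧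
⟦suc⟧ = ⟦⟧-homo-+ 1

-- Cancellation and reciprocals of positive rationals.

*-cancelʳ-pos : ∀ r .{{_ : Positive r}} {p q} → p * r ≡ q * r → p ≡ q
*-cancelʳ-pos r pr≡qr =
  ≤-antisym (*-cancelʳ-≤-pos r (≤-reflexive pr≡qr))
            (*-cancelʳ-≤-pos r (≤-reflexive (sym pr≡qr)))

inv : (p : ℚ) → .{{Positive p}} → ℚ
inv p = (1/ p) {{pos⇒nonZero p}}

inv-inverse : ∀ p .{{_ : Positive p}} → inv p * p ≡ 1ℚ
inv-inverse p = *-inverseˡ p {{pos⇒nonZero p}}

-- Reduces the reciprocal identities below to division-free equations with value `1`, which a ring
-- solver can handle.
inv-unique : ∀ p .{{_ : Positive p}} {q} → q * p ≡ 1ℚ → inv p ≡ q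
inv-unique p qp≡1 = *-cancelʳ-pos p (trans (inv-inverse p) (sym qp≡1))

-- Rising factorials, factorials and their reciprocals.

rising-head : ∀ a j → rising a (suc j) ≡ a * rising (1ℚ + a) j
rising-head a zero    = solve 1 (λ a → con 1ℚ :* (a :+ con 0ℚ) := a :* con 1ℚ) refl a
rising-head a (suc j) = begin
  rising a (suc j) * (a + ⟦ suc j ⟧)
    ≡⟨ cong₂ (λ r y → r * (a + y)) (rising-head a j) (⟦suc⟧ j) ⟩
  a * rising (1ℚ + a) j * (a + (1ℚ + ⟦ j ⟧))
    ≡⟨ solve 3 (λ a r y → a :* r :* (a :+ (con 1ℚ :+ y)) := a :* (r :* (con 1ℚ :+ a :+ y)))
         refl a (rising (1ℚ + a) j) ⟦ j ⟧ ⟩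
  a * rising (1ℚ + a) (suc j) ∎
  where open ≡-Reasoning

-- The factor with index `n` is `-n + n`, and the product contains it as soon as `k` exceeds `n`.
rising-neg-vanishes : ∀ n k → n < k → rising (- ⟦ n ⟧) k ≡ 0ℚ
rising-neg-vanishes n (suc k) n<1+k with n ℕ.≟ k
... | yes refl = trans (cong (rising (- ⟦ n ⟧) n *_) (+-inverseˡ ⟦ n ⟧)) (*-zeroʳ (rising (- ⟦ n ⟧) n))
... | no  n≢k  =
  trans (cong (_* (- ⟦ n ⟧ + ⟦ k ⟧)) (rising-neg-vanishes n k (ℕ.≤∧≢⇒< (ℕ.≤-pred n<1+k) n≢k)))
        (*-zeroˡ (- ⟦ n ⟧ + ⟦ k ⟧))

rising-neg-suc : ∀ n k → rising (- ⟦ suc n ⟧) (suc k) ≡ - (1ℚ + ⟦ n ⟧) * rising (- ⟦ n ⟧) k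
rising-neg-suc n k = begin
  rising (- ⟦ suc n ⟧) (suc k)
    ≡⟨ rising-head (- ⟦ suc n ⟧) k ⟩
  - ⟦ suc n ⟧ * rising (1ℚ + - ⟦ suc n ⟧) k
    ≡⟨ cong (λ y → - y * rising (1ℚ + - y) k) (⟦suc⟧ n) ⟩
  - (1ℚ + ⟦ n ⟧) * rising (1ℚ + - (1ℚ + ⟦ n ⟧)) k
    ≡⟨ cong (λ a → - (1ℚ + ⟦ n ⟧) * rising a k)
         (solve 1 (λ x → con 1ℚ :+ :- (con 1ℚ :+ x) := :- x) refl ⟦ n ⟧) ⟩
  - (1ℚ + ⟦ n ⟧) * rising (- ⟦ n ⟧) k ∎
  where open ≡-Reasoning

risingInv : (a : ℚ) → .{{Positive a}} → ℕ → ℚ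
risingInv a k = inv (rising a k) {{rising-pos a k}}

-- Oriented from `k` up to `suc k`: reciprocals of lower index become polynomial multiples of the
-- one of highest index.
risingInv-last : ∀ a .{{_ : Positive a}} k → risingInv a k ≡ risingInv a (suc k) * (a + ⟦ k ⟧)
risingInv-last a k = inv-unique r {{rising-pos a k}} (begin
  i * z * r      ≡⟨ solve 3 (λ i z r → i :* z :* r := i :* (r :* z)) refl i z r ⟩
  i * (r * z)    ≡⟨ inv-inverse (r * z) {{rising-pos a (suc k)}} ⟩
  1ℚ             ∎)
  where
  open ≡-Reasoning
  r = rising a k
  i = risingInv a (suc k)
  z = a + ⟦ k ⟧

-- The shifted base is a separate `b` because `⟦ suc n ⟧ + 3/2` equals `1 + (⟦ n ⟧ + 3/2)` only
-- propositionally.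
risingInv-head : ∀ a b .{{_ : Positive a}} .{{_ : Positive b}} k → b ≡ 1ℚ + a →
                 risingInv b k ≡ a * risingInv a (suc k)
risingInv-head a b k b≡1+a = inv-unique (rising b k) {{rising-pos b k}} (begin
  a * i * rising b k            ≡⟨ solve 3 (λ a i r → a :* i :* r := i :* (a :* r)) refl a i (rising b k) ⟩
  i * (a * rising b k)          ≡⟨ cong (λ z → i * (a * rising z k)) b≡1+a ⟩
  i * (a * rising (1ℚ + a) k)   ≡⟨ cong (i *_) (rising-head a k) ⟨
  i * rising a (suc k)          ≡⟨ inv-inverse (rising a (suc k)) {{rising-pos a (suc k)}} ⟩
  1ℚ                            ∎)
  where
  open ≡-Reasoning
  i = risingInv a (suc k)

⟦!⟧-pos : ∀ k → Positive ⟦ k ! ⟧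
⟦!⟧-pos k = normalize-pos (k !) 1 {{_}} {{k !≢0}}

factInv : ℕ → ℚ
factInv k = inv ⟦ k ! ⟧ {{⟦!⟧-pos k}}

factInv-last : ∀ k → factInv k ≡ factInv (suc k) * (1ℚ + ⟦ k ⟧)
factInv-last k = inv-unique ⟦ k ! ⟧ {{⟦!⟧-pos k}} (begin
  i * (1ℚ + ⟦ k ⟧) * ⟦ k ! ⟧     ≡⟨ *-assoc i (1ℚ + ⟦ k ⟧) ⟦ k ! ⟧ ⟩
  i * ((1ℚ + ⟦ k ⟧) * ⟦ k ! ⟧)   ≡⟨ cong (λ z → i * (z * ⟦ k ! ⟧)) (⟦suc⟧ k) ⟨
  i * (⟦ suc k ⟧ * ⟦ k ! ⟧)      ≡⟨ cong (i *_) (⟦⟧-homo-* (suc k) (k !)) ⟨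
  i * ⟦ suc k ! ⟧                ≡⟨ inv-inverse ⟦ suc k ! ⟧ {{⟦!⟧-pos (suc k)}} ⟩
  1ℚ                             ∎)
  where
  open ≡-Reasoning
  i = factInv (suc k)

-- `sum` unfolds at its first entry, whereas telescoping splits off the last.
sum-last : ∀ (f : ℕ → ℚ) N →
           sum {suc N} (λ k → f (toℕ k)) ≡ sum {N} (λ k → f (toℕ k)) + f N
sum-last f zero    = +-comm (f 0) 0ℚ
sum-last f (suc N) =
  trans (cong (λ z → f 0 + z) (sum-last (λ k → f (suc k)) N))
        (sym (+-assoc (f 0) (sum {N} (λ k → f (suc (toℕ k)))) (f (suc N))))

n+3/2-pos : ∀ n → Positive (⟦ n ⟧ + + 3 / 2)
n+3/2-pos n = nonNeg+pos⇒pos ⟦ n ⟧ {{normalize-nonNeg n 1}} (+ 3 / 2)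

n+3/2Inv : ℕ → ℕ → ℚ
n+3/2Inv n = risingInv (⟦ n ⟧ + + 3 / 2) {{n+3/2-pos n}}

⟦4*[1+k]+1⟧ : ∀ k → ⟦ 4 ℕ.* suc k ℕ.+ 1 ⟧ ≡ + 4 / 1 * (1ℚ + ⟦ k ⟧) + 1ℚ
⟦4*[1+k]+1⟧ k = trans (⟦⟧-homo-+ (4 ℕ.* suc k) 1)
  (cong (_+ 1ℚ) (trans (⟦⟧-homo-* 4 (suc k)) (cong (+ 4 / 1 *_) (⟦suc⟧ k))))

-- The well-poised sum with a free parameter `d`.

module WellPoised (d : ℚ) .{{d>0 : Positive d}} where

  -- With a = 1/2, each lower parameter is 1 + a minus an upper one: `n + 3/2` pairs with `-n`, `d`
  -- with `c`, and `k!` = (1)_k with 1/2. The factor 4k+1 is (a+2k)/a, so the sum is a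
  -- very-well-poised 4F3 at -1.
  c : ℚ
  c = + 3 / 2 - d

  -- Three separate reciprocals replace a single quotient, so that each can be shifted on its own
  -- and then treated as an atom by the ring solver.
  term : ℕ → ℕ → ℚ
  term n k = (- 1ℚ) ^ k * ⟦ 4 ℕ.* k ℕ.+ 1 ⟧ *
    ((rising (- ⟦ n ⟧) k * rising c k * rising ½ k) *
     (factInv k * n+3/2Inv n k * risingInv d k))

  S : ℕ → ℕ → ℚ
  S n N = sum {N} (λ k → term n (toℕ k))

  -- A Zeilberger certificate: (n+d) t(n+1,k) - (n+3/2) t(n,k) = G n k - G n (k-1),
  -- where G n (-1) = 0.
  G : ℕ → ℕ → ℚ
  G n k = + 2 / 1 * (⟦ n ⟧ + + 3 / 2) * ((- 1ℚ) ^ suc k *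
    ((rising (- ⟦ n ⟧) k * rising c (suc k) * rising ½ (suc k)) *
     (factInv k * n+3/2Inv n (suc k) * risingInv d k)))

  -- Removes the boundary term of the telescoped sum once the summation range passes `n`.
  G-vanishes : ∀ n k → n < k → G n k ≡ 0ℚ
  G-vanishes n k n<k = begin
    G n k  ≡⟨ cong (λ r → a * (s * ((r * p * q) * i))) (rising-neg-vanishes n k n<k) ⟩
    a * (s * ((0ℚ * p * q) * i))
      ≡⟨ solve 5 (λ a s p q i → a :* (s :* ((con 0ℚ :* p :* q) :* i)) := con 0ℚ) refl a s p q i ⟩
    0ℚ     ∎
    where
    open ≡-Reasoning
    a = + 2 / 1 * (⟦ n ⟧ + + 3 / 2)
    s = (- 1ℚ) ^ suc k
    p = rising c (suc k)
    q = rising ½ (suc k)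
    i = factInv k * n+3/2Inv n (suc k) * risingInv d k

  -- All four quantities are polynomial multiples of B below, which carries the
  -- lowest rising factorials above and the highest ones below the fraction bar.
  term-recurrence : ∀ n k →
    (⟦ n ⟧ + d) * term (suc n) (suc k) ≡
    (⟦ n ⟧ + + 3 / 2) * term n (suc k) + (G n (suc k) - G n k)
  term-recurrence n k = begin
    (x + d) * term (suc n) (suc k)
      ≡⟨ cong ((x + d) *_) term₁ ⟩
    (x + d) * (B * (- 1ℚ * f * (- (1ℚ + x)) * a))
      -- With `B` factored out, a polynomial identity in `x`, `y`, `d` remains; it depends on `c`
      -- being `3/2 - d`.
      ≡⟨ solve 4 (λ x y d B →
           let a  = x :+ con (+ 3 / 2)
               a′ = a :+ (con 1ℚ :+ y)
               c  = con (+ 3 / 2) :- d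
               f  = con (+ 4 / 1) :* (con 1ℚ :+ y) :+ con 1ℚ
           in (x :+ d) :* (B :* (con (- 1ℚ) :* f :* (:- (con 1ℚ :+ x)) :* a))
              :=
              a :* (B :* (con (- 1ℚ) :* f :* (:- x :+ y) :* a′)) :+
              (B :* (con (+ 2 / 1) :* a :* (:- x :+ y) :* (c :+ (con 1ℚ :+ y)) :* (con ½ :+ (con 1ℚ :+ y))) :-
               B :* (con (- (+ 2 / 1)) :* a :* (con 1ℚ :+ y) :* a′ :* (d :+ y))))
           refl x y d B ⟩
    a * (B * (- 1ℚ * f * (- x + y) * a′)) +
    (B * (+ 2 / 1 * a * (- x + y) * (c + (1ℚ + y)) * (½ + (1ℚ + y))) -
     B * (- (+ 2 / 1) * a * (1ℚ + y) * a′ * (d + y)))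
      ≡⟨ cong₂ _+_ (cong (a *_) term₀) (cong₂ _-_ G₁ G₀) ⟨
    a * term n (suc k) + (G n (suc k) - G n k) ∎
    where
    open ≡-Reasoning
    x = ⟦ n ⟧
    y = ⟦ k ⟧
    a = x + + 3 / 2
    a′ = a + (1ℚ + y)
    f = + 4 / 1 * (1ℚ + y) + 1ℚ
    s = (- 1ℚ) ^ k
    A = rising (- x) k
    p = rising c (suc k)
    q = rising ½ (suc k)
    F = factInv (suc k)
    -- The index is k+2 because `G n (suc k)` has (n+3/2)_{k+2} in its denominator.
    E = n+3/2Inv n (suc (suc k))
    D = risingInv d (suc k)
    B = s * (A * p * q) * (F * E * D)

    E₀ : n+3/2Inv n (suc k) ≡ E * a′
    E₀ = trans (risingInv-last a {{n+3/2-pos n}} (suc k)) (cong (λ z → E * (a + z)) (⟦suc⟧ k))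

    E₁ : n+3/2Inv (suc n) (suc k) ≡ a * E
    E₁ = risingInv-head a (⟦ suc n ⟧ + + 3 / 2) {{n+3/2-pos n}} {{n+3/2-pos (suc n)}} (suc k)
           (trans (cong (_+ + 3 / 2) (⟦suc⟧ n)) (+-assoc 1ℚ x (+ 3 / 2)))

    term₀ : term n (suc k) ≡ B * (- 1ℚ * f * (- x + y) * a′)
    term₀ = begin
      term n (suc k)
        ≡⟨ cong₂ (λ u v → (- 1ℚ) * s * u * ((A * (- x + y) * p * q) * (F * v * D))) (⟦4*[1+k]+1⟧ k) E₀ ⟩
      (- 1ℚ) * s * f * ((A * (- x + y) * p * q) * (F * (E * a′) * D))
        ≡⟨ solve 10 (λ s f A z p q F E a′ D →
             con (- 1ℚ) :* s :* f :* ((A :* z :* p :* q) :* (F :* (E :* a′) :* D)) :=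
             (s :* (A :* p :* q) :* (F :* E :* D)) :* (con (- 1ℚ) :* f :* z :* a′))
             refl s f A (- x + y) p q F E a′ D ⟩
      B * (- 1ℚ * f * (- x + y) * a′) ∎

    term₁ : term (suc n) (suc k) ≡ B * (- 1ℚ * f * (- (1ℚ + x)) * a)
    term₁ = begin
      term (suc n) (suc k)
        ≡⟨ cong₂ (λ u v → (- 1ℚ) * s * u * ((v * p * q) * (F * n+3/2Inv (suc n) (suc k) * D)))
             (⟦4*[1+k]+1⟧ k) (rising-neg-suc n k) ⟩
      (- 1ℚ) * s * f * ((- (1ℚ + x) * A * p * q) * (F * n+3/2Inv (suc n) (suc k) * D))
        ≡⟨ cong (λ u → (- 1ℚ) * s * f * ((- (1ℚ + x) * A * p * q) * (F * u * D))) E₁ ⟩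
      (- 1ℚ) * s * f * ((- (1ℚ + x) * A * p * q) * (F * (a * E) * D))
        ≡⟨ solve 10 (λ s f A z p q F E a D →
             con (- 1ℚ) :* s :* f :* ((z :* A :* p :* q) :* (F :* (a :* E) :* D)) :=
             (s :* (A :* p :* q) :* (F :* E :* D)) :* (con (- 1ℚ) :* f :* z :* a))
             refl s f A (- (1ℚ + x)) p q F E a D ⟩
      B * (- 1ℚ * f * (- (1ℚ + x)) * a) ∎

    G₀ : G n k ≡ B * (- (+ 2 / 1) * a * (1ℚ + y) * a′ * (d + y))
    G₀ = begin
      G n k
        ≡⟨ cong₂ (λ u v → + 2 / 1 * a * ((- 1ℚ) * s * ((A * p * q) * (u * v * risingInv d k)))) (factInv-last k) E₀ ⟩
      + 2 / 1 * a * ((- 1ℚ) * s * ((A * p * q) * (F * (1ℚ + y) * (E * a′) * risingInv d k)))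
        ≡⟨ cong (λ u → + 2 / 1 * a * ((- 1ℚ) * s * ((A * p * q) * (F * (1ℚ + y) * (E * a′) * u)))) (risingInv-last d k) ⟩
      + 2 / 1 * a * ((- 1ℚ) * s * ((A * p * q) * (F * (1ℚ + y) * (E * a′) * (D * (d + y)))))
        ≡⟨ solve 11 (λ a s A p q F z E a′ D w →
             con (+ 2 / 1) :* a :* (con (- 1ℚ) :* s :* ((A :* p :* q) :* (F :* z :* (E :* a′) :* (D :* w)))) :=
             (s :* (A :* p :* q) :* (F :* E :* D)) :* (con (- (+ 2 / 1)) :* a :* z :* a′ :* w))
             refl a s A p q F (1ℚ + y) E a′ D (d + y) ⟩
      B * (- (+ 2 / 1) * a * (1ℚ + y) * a′ * (d + y)) ∎

    G₁ : G n (suc k) ≡ B * (+ 2 / 1 * a * (- x + y) * (c + (1ℚ + y)) * (½ + (1ℚ + y)))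
    G₁ = begin
      G n (suc k)
        ≡⟨ cong (λ u → + 2 / 1 * a * ((- 1ℚ) * ((- 1ℚ) * s) *
             ((A * (- x + y) * (p * (c + u)) * (q * (½ + u))) * (F * E * D)))) (⟦suc⟧ k) ⟩
      + 2 / 1 * a * ((- 1ℚ) * ((- 1ℚ) * s) *
        ((A * (- x + y) * (p * (c + (1ℚ + y))) * (q * (½ + (1ℚ + y)))) * (F * E * D)))
        ≡⟨ solve 9 (λ a s A z p w q v i →
             con (+ 2 / 1) :* a :* (con (- 1ℚ) :* (con (- 1ℚ) :* s) :*
               ((A :* z :* (p :* w) :* (q :* v)) :* i)) :=
             (s :* (A :* p :* q) :* i) :* (con (+ 2 / 1) :* a :* z :* w :* v))
             refl a s A (- x + y) p (c + (1ℚ + y)) q (½ + (1ℚ + y)) (F * E * D) ⟩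
      B * (+ 2 / 1 * a * (- x + y) * (c + (1ℚ + y)) * (½ + (1ℚ + y))) ∎

  -- Summing the termwise recurrence over 0, ..., k leaves only the last certificate value; the
  -- index 0 is checked directly.
  S-recurrence : ∀ n k →
    (⟦ n ⟧ + d) * S (suc n) (suc k) ≡ (⟦ n ⟧ + + 3 / 2) * S n (suc k) + G n k
  S-recurrence n zero = begin
    (x + d) * 1ℚ
      ≡⟨ solve 2 (λ x d → (x :+ d) :* con 1ℚ :=
           (x :+ con (+ 3 / 2)) :* con 1ℚ :+ con 1ℚ :* (d :- con (+ 3 / 2))) refl x d ⟩
    a * 1ℚ + 1ℚ * (d - + 3 / 2)
      -- The `1` is the reciprocal of the empty product; writing it as `e * (a + 0)` produces the
      -- reciprocal of (n+3/2)_1 found in `G n 0`.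
      ≡⟨ cong (λ z → a * 1ℚ + z * (d - + 3 / 2)) (risingInv-last a {{n+3/2-pos n}} 0) ⟩
    a * 1ℚ + e * (a + 0ℚ) * (d - + 3 / 2)
      ≡⟨ solve 3 (λ a e d →
           a :* con 1ℚ :+ e :* (a :+ con 0ℚ) :* (d :- con (+ 3 / 2)) :=
           a :* con 1ℚ :+ con (+ 2 / 1) :* a :* (con (- 1ℚ) :*
             ((con 1ℚ :* (con 1ℚ :* ((con (+ 3 / 2) :- d) :+ con 0ℚ)) :* con ½) :*
              (con 1ℚ :* e :* con 1ℚ)))) refl a e d ⟩
    a * S n 1 + G n 0 ∎
    where
    open ≡-Reasoning
    x = ⟦ n ⟧
    a = x + + 3 / 2
    e = n+3/2Inv n 1
  S-recurrence n (suc k) = begin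
    (x + d) * S (suc n) (suc (suc k))
      ≡⟨ cong ((x + d) *_) (sum-last (term (suc n)) (suc k)) ⟩
    (x + d) * (S (suc n) (suc k) + t₁)
      ≡⟨ *-distribˡ-+ (x + d) (S (suc n) (suc k)) t₁ ⟩
    (x + d) * S (suc n) (suc k) + (x + d) * t₁
      ≡⟨ cong₂ _+_ (S-recurrence n k) (term-recurrence n k) ⟩
    a * S n (suc k) + G n k + (a * t₀ + (G n (suc k) - G n k))
      ≡⟨ solve 5 (λ a S t g g′ → a :* S :+ g :+ (a :* t :+ (g′ :- g)) := a :* (S :+ t) :+ g′)
           refl a (S n (suc k)) t₀ (G n k) (G n (suc k)) ⟩
    a * (S n (suc k) + t₀) + G n (suc k)
      ≡⟨ cong (λ z → a * z + G n (suc k)) (sum-last (term n) (suc k)) ⟨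
    a * S n (suc (suc k)) + G n (suc k) ∎
    where
    open ≡-Reasoning
    x = ⟦ n ⟧
    a = x + + 3 / 2
    t₀ = term n (suc k)
    t₁ = term (suc n) (suc k)

  S-zero : ∀ N → S 0 (suc N) ≡ 1ℚ
  S-zero zero    = refl
  S-zero (suc k) = begin
    S 0 (suc (suc k))              ≡⟨ sum-last (term 0) (suc k) ⟩
    S 0 (suc k) + term 0 (suc k)   ≡⟨ cong₂ _+_ (S-zero k) term≡0 ⟩
    1ℚ                             ∎
    where
    open ≡-Reasoning
    a = (- 1ℚ) ^ suc k * ⟦ 4 ℕ.* suc k ℕ.+ 1 ⟧
    p = rising c (suc k)
    q = rising ½ (suc k)
    i = factInv (suc k) * n+3/2Inv 0 (suc k) * risingInv d (suc k)
    term≡0 : term 0 (suc k) ≡ 0ℚ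
    term≡0 = trans
      (cong (λ r → a * ((r * p * q) * i)) (rising-neg-vanishes 0 (suc k) (s≤s z≤n)))
      (solve 4 (λ a p q i → a :* ((con 0ℚ :* p :* q) :* i) := con 0ℚ) refl a p q i)

  -- Induction on `n` with `d` fixed. Any cut-off beyond `n` is allowed, so the hypothesis is
  -- available at the same cut-off, and the recurrence without its boundary term multiplies the sum
  -- by (n+3/2)/(n+d).
  S-closed : ∀ n N → n < N → S n N * rising d n ≡ rising (+ 3 / 2) n
  S-closed zero    (suc N) _ = trans (*-identityʳ (S 0 (suc N))) (S-zero N)
  S-closed (suc n) (suc N) (s≤s n<N) = begin
    S (suc n) (suc N) * (r * (d + x))
      ≡⟨ solve 4 (λ S r d x → S :* (r :* (d :+ x)) := (x :+ d) :* S :* r) refl (S (suc n) (suc N)) r d x ⟩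
    (x + d) * S (suc n) (suc N) * r
      ≡⟨ cong (_* r) (S-recurrence n N) ⟩
    ((x + + 3 / 2) * S n (suc N) + G n N) * r
      ≡⟨ cong (λ z → ((x + + 3 / 2) * S n (suc N) + z) * r) (G-vanishes n N n<N) ⟩
    ((x + + 3 / 2) * S n (suc N) + 0ℚ) * r
      ≡⟨ solve 3 (λ x S r → ((x :+ con (+ 3 / 2)) :* S :+ con 0ℚ) :* r := S :* r :* (con (+ 3 / 2) :+ x))
           refl x (S n (suc N)) r ⟩
    S n (suc N) * r * (+ 3 / 2 + x)
      ≡⟨ cong (_* (+ 3 / 2 + x)) (S-closed n (suc N) (ℕ.m<n⇒m<1+n n<N)) ⟩
    rising (+ 3 / 2) (suc n) ∎
    where
    open ≡-Reasoning
    x = ⟦ n ⟧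
    r = rising d n

-- The closed form at `d = 2n+2`.

⟦2n+2⟧ : ∀ n → ⟦ 2 ℕ.* n ℕ.+ 2 ⟧ ≡ + 2 / 1 * ⟦ n ⟧ + + 2 / 1
⟦2n+2⟧ n = trans (⟦⟧-homo-+ (2 ℕ.* n) 2) (cong (_+ + 2 / 1) (⟦⟧-homo-* 2 n))

2n+2-pos : ∀ n → Positive ⟦ 2 ℕ.* n ℕ.+ 2 ⟧
2n+2-pos n = subst (λ m → Positive ⟦ m ⟧) (ℕ.+-comm 2 (2 ℕ.* n)) (normalize-pos (2 ℕ.+ 2 ℕ.* n) 1)

q : ℚ
q = + (2 ℕ.^ 2) / (3 ℕ.^ 3)

-- Behind this is (2n+2)_n = (3n+1)!/(2n+1)!, where (3n+1)! = 27^n (2/3)_n (1)_n (4/3)_n and (2n+1)!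
-- = 4^n (1)_n (3/2)_n. The proof is by induction on `n`.
risings-3n : ∀ n →
  q ^ n * rising (+ 3 / 2) n * rising ⟦ 2 ℕ.* n ℕ.+ 2 ⟧ n ≡ rising (+ 4 / 3) n * rising (+ 2 / 3) n
risings-3n zero    = refl
risings-3n (suc n) =
  -- Raising `n` by one moves the base from 2n+2 to 2n+4; the skipped factors `D` = 2n+2 and `1 + D`
  -- = 2n+3 are multiplied in and cancelled at the end.
  *-cancelʳ-pos D {{2n+2-pos n}} (*-cancelʳ-pos (1ℚ + D) {{1+D>0}} (begin
    q * Q * (R * (+ 3 / 2 + x)) * r′ * D * (1ℚ + D)
      ≡⟨ solve 6 (λ c Q R z r D →
           c :* Q :* (R :* z) :* r :* D :* (con 1ℚ :+ D) :=
           c :* z :* Q :* R :* (D :* ((con 1ℚ :+ D) :* r))) refl q Q R (+ 3 / 2 + x) r′ D ⟩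
    q * (+ 3 / 2 + x) * Q * R * (D * ((1ℚ + D) * r′))
      ≡⟨ cong (q * (+ 3 / 2 + x) * Q * R *_) shift ⟩
    q * (+ 3 / 2 + x) * Q * R * (r * (D + x) * (D + (1ℚ + x)) * (D + (1ℚ + (1ℚ + x))))
      ≡⟨ solve 6 (λ z Q R r D x →
           con q :* z :* Q :* R :* (r :* (D :+ x) :* (D :+ (con 1ℚ :+ x)) :* (D :+ (con 1ℚ :+ (con 1ℚ :+ x)))) :=
           Q :* R :* r :* (con q :* z :* (D :+ x) :* (D :+ (con 1ℚ :+ x)) :* (D :+ (con 1ℚ :+ (con 1ℚ :+ x)))))
           refl (+ 3 / 2 + x) Q R r D x ⟩
    Q * R * r * (q * (+ 3 / 2 + x) * (D + x) * (D + (1ℚ + x)) * (D + (1ℚ + (1ℚ + x))))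
      ≡⟨ cong₂ (λ z D → z * (q * (+ 3 / 2 + x) * (D + x) * (D + (1ℚ + x)) * (D + (1ℚ + (1ℚ + x)))))
           (risings-3n n) (⟦2n+2⟧ n) ⟩
    T * U * (q * (+ 3 / 2 + x) * (D′ + x) * (D′ + (1ℚ + x)) * (D′ + (1ℚ + (1ℚ + x))))
      -- The factors `D + x`, ... are 3x+2, 3x+3, 3x+4. Their 27 cancels against `q` = 4/27, and the
      -- remaining 4(x+1)(x+3/2) is (2x+2)(2x+3).
      ≡⟨ solve 3 (λ T U x → let D = con (+ 2 / 1) :* x :+ con (+ 2 / 1) in
           T :* U :* (con q :* (con (+ 3 / 2) :+ x) :* (D :+ x) :* (D :+ (con 1ℚ :+ x)) :* (D :+ (con 1ℚ :+ (con 1ℚ :+ x)))) :=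
           T :* (con (+ 4 / 3) :+ x) :* (U :* (con (+ 2 / 3) :+ x)) :* D :* (con 1ℚ :+ D))
           refl T U x ⟩
    T * (+ 4 / 3 + x) * (U * (+ 2 / 3 + x)) * D′ * (1ℚ + D′)
      ≡⟨ cong (λ D → T * (+ 4 / 3 + x) * (U * (+ 2 / 3 + x)) * D * (1ℚ + D)) (⟦2n+2⟧ n) ⟨
    T * (+ 4 / 3 + x) * (U * (+ 2 / 3 + x)) * D * (1ℚ + D) ∎))
  where
  open ≡-Reasoning
  x = ⟦ n ⟧
  D = ⟦ 2 ℕ.* n ℕ.+ 2 ⟧
  D′ = + 2 / 1 * x + + 2 / 1
  Q = q ^ n
  R = rising (+ 3 / 2) n
  T = rising (+ 4 / 3) n
  U = rising (+ 2 / 3) n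
  r = rising D n
  r′ = rising ⟦ 2 ℕ.* suc n ℕ.+ 2 ⟧ (suc n)

  1+D>0 : Positive (1ℚ + D)
  1+D>0 = pos+pos⇒pos 1ℚ D {{2n+2-pos n}}

  2+D : ⟦ 2 ℕ.* suc n ℕ.+ 2 ⟧ ≡ 1ℚ + (1ℚ + D)
  2+D = begin
    ⟦ 2 ℕ.* suc n ℕ.+ 2 ⟧          ≡⟨ cong (λ m → ⟦ m ℕ.+ 2 ⟧) (ℕ.*-suc 2 n) ⟩
    ⟦ suc (suc (2 ℕ.* n ℕ.+ 2)) ⟧  ≡⟨ ⟦suc⟧ (suc (2 ℕ.* n ℕ.+ 2)) ⟩
    1ℚ + ⟦ suc (2 ℕ.* n ℕ.+ 2) ⟧   ≡⟨ cong (λ z → 1ℚ + z) (⟦suc⟧ (2 ℕ.* n ℕ.+ 2)) ⟩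
    1ℚ + (1ℚ + D)                  ∎

  -- Both sides are (2n+2)_{n+3}, split after its first two factors or before its last three.
  shift : D * ((1ℚ + D) * r′) ≡ r * (D + x) * (D + (1ℚ + x)) * (D + (1ℚ + (1ℚ + x)))
  shift = begin
    D * ((1ℚ + D) * r′)
      ≡⟨ cong (λ z → D * ((1ℚ + D) * rising z (suc n))) 2+D ⟩
    D * ((1ℚ + D) * rising (1ℚ + (1ℚ + D)) (suc n))
      ≡⟨ cong (D *_) (rising-head (1ℚ + D) (suc n)) ⟨
    D * rising (1ℚ + D) (suc (suc n))
      ≡⟨ rising-head D (suc (suc n)) ⟨
    r * (D + x) * (D + ⟦ suc n ⟧) * (D + ⟦ suc (suc n) ⟧)
      ≡⟨ cong₂ (λ y z → r * (D + x) * (D + y) * (D + z)) (⟦suc⟧ n)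
           (trans (⟦suc⟧ (suc n)) (cong (λ z → 1ℚ + z) (⟦suc⟧ n))) ⟩
    r * (D + x) * (D + (1ℚ + x)) * (D + (1ℚ + (1ℚ + x))) ∎

-- One of the two factors (3/2)_n combines with `q ^ n` and (2n+2)_n into the denominator and
-- cancels it; the other remains.
closedForm-rising : ∀ n → closedForm n * rising ⟦ 2 ℕ.* n ℕ.+ 2 ⟧ n ≡ rising (+ 3 / 2) n
closedForm-rising n = begin
  Q * (R * (R * 1ℚ) * i) * r
    ≡⟨ solve 4 (λ Q R i r → Q :* (R :* (R :* con 1ℚ) :* i) :* r := R :* (i :* (Q :* R :* r))) refl Q R i r ⟩
  R * (i * (Q * R * r))
    ≡⟨ cong (λ z → R * (i * z)) (risings-3n n) ⟩
  R * (i * P)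
    ≡⟨ cong (R *_) (inv-inverse P {{P>0}}) ⟩
  R * 1ℚ
    ≡⟨ *-identityʳ R ⟩
  R ∎
  where
  open ≡-Reasoning
  Q = q ^ n
  R = rising (+ 3 / 2) n
  P = rising (+ 4 / 3) n * rising (+ 2 / 3) n
  P>0 : Positive P
  P>0 = pos*pos⇒pos (rising (+ 4 / 3) n) {{rising-pos (+ 4 / 3) n}}
                    (rising (+ 2 / 3) n) {{rising-pos (+ 2 / 3) n}}
  i = inv P {{P>0}}
  r = rising ⟦ 2 ℕ.* n ℕ.+ 2 ⟧ n

-- Bridges the single quotient in `summand` and the three reciprocals in `term`.
1/[p*q*r] : ∀ p q r .{{_ : Positive p}} .{{_ : Positive q}} .{{_ : Positive r}} .{{_ : NonZero (p * q * r)}} →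
            1/ (p * q * r) ≡ inv p * inv q * inv r
1/[p*q*r] p q r = inv-unique (p * q * r)
  {{pos*pos⇒pos (p * q) {{pos*pos⇒pos p q}} r}} (begin
  inv p * inv q * inv r * (p * q * r)
    ≡⟨ solve 6 (λ i j k p q r → i :* j :* k :* (p :* q :* r) := (i :* p) :* (j :* q) :* (k :* r))
         refl (inv p) (inv q) (inv r) p q r ⟩
  inv p * p * (inv q * q) * (inv r * r)
    ≡⟨ cong₂ _*_ (cong₂ _*_ (inv-inverse p) (inv-inverse q)) (inv-inverse r) ⟩
  1ℚ ∎)
  where open ≡-Reasoning

-- Specialisation of `d` to `2n+2` and convergence of the series.

module _ (n : ℕ) where
  open WellPoised ⟦ 2 ℕ.* n ℕ.+ 2 ⟧ {{2n+2-pos n}}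

  c≡-2n-½ : - ⟦ 2 ℕ.* n ⟧ - ½ ≡ c
  c≡-2n-½ = trans
    (solve 1 (λ y → :- y :- con ½ := con (+ 3 / 2) :- (y :+ con (+ 2 / 1))) refl ⟦ 2 ℕ.* n ⟧)
    (cong (λ z → + 3 / 2 - z) (sym (⟦⟧-homo-+ (2 ℕ.* n) 2)))

  summand≡term : ∀ k → summand n k ≡ term n k
  summand≡term k = cong₂ (λ a i → (- 1ℚ) ^ k * ⟦ 4 ℕ.* k ℕ.+ 1 ⟧ *
      ((rising (- ⟦ n ⟧) k * rising a k * rising ½ k) * i))
    c≡-2n-½
    (1/[p*q*r] ⟦ k ! ⟧ (rising (⟦ n ⟧ + + 3 / 2) k) (rising ⟦ 2 ℕ.* n ℕ.+ 2 ⟧ k)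
      {{⟦!⟧-pos k}} {{rising-pos (⟦ n ⟧ + + 3 / 2) {{n+3/2-pos n}} k}}
      {{rising-pos ⟦ 2 ℕ.* n ℕ.+ 2 ⟧ {{2n+2-pos n}} k}} {{denominator≢0 n k}})

  -- Multiplied by the positive (2n+2)_n, both sides become (3/2)_n.
  partialSum≡closedForm : ∀ N → n < N → sum {N} (λ k → summand n (toℕ k)) ≡ closedForm n
  partialSum≡closedForm N n<N =
    *-cancelʳ-pos (rising ⟦ 2 ℕ.* n ℕ.+ 2 ⟧ n) {{rising-pos ⟦ 2 ℕ.* n ℕ.+ 2 ⟧ {{2n+2-pos n}} n}} (begin
    sum {N} (λ k → summand n (toℕ k)) * r   ≡⟨ cong (_* r) (sum-cong-≗ {N} (λ k → summand≡term (toℕ k))) ⟩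
    S n N * r                               ≡⟨ S-closed n N n<N ⟩
    rising (+ 3 / 2) n                      ≡⟨ closedForm-rising n ⟨
    closedForm n * r                        ∎)
    where
    open ≡-Reasoning
    r = rising ⟦ 2 ℕ.* n ℕ.+ 2 ⟧ n

theorem2 : (n : ℕ) →
    HasSum (summand n) (closedForm n) ×
    ((k : ℕ) → n < k → rising (- ⟦ n ⟧) k ≡ 0ℚ)
theorem2 n = hasSum , rising-neg-vanishes n
  where
  hasSum : HasSum (summand n) (closedForm n)
  -- The partial sums are constant from `suc n` on, so this threshold serves every `ε` and the
  -- distance is exactly 0.
  hasSum ε 0<ε = suc n , λ N n<N →
    subst (ℚ._< ε)
      (sym (cong ∣_∣ (trans (cong (_- closedForm n) (partialSum≡closedForm n N n<N))
                            (+-inverseʳ (closedForm n)))))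
      0<ε
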